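{- Let $F$ be a one-dimensional tropical fan in $\mathbb{R}^n$ whose rays span $\mathbb{R}^n$. For every gallery class $P$ of $F$ with $k+1\ge2$ rays there exists a $\mathbb{Z}$-linear map $\pi:\mathbb{Z}^n\to\mathbb{Z}^k$ such that $\pi_*(F)$ is (isomorphic to) a one-dimensional Bergman fan in $\mathbb{R}^k$ with respect to the lattice $\mathbb{Z}^k$.
   Context: A one-dimensional tropical fan $F$ in $\mathbb{R}^n$ consists of finitely many distinct rays $\mathbb{R}_+v_1,\dots,\mathbb{R}_+v_q$ (and the origin), with $v_i\in\mathbb{Z}^n$ primitive, together with positive integer weights $\omega_1,\dots,\omega_q$ satisfying the balancing condition $\sum_i\omega_iv_i=0$. The push-forward $\pi_*(F)$ under an integer linear map $\pi$ has as rays the half-lines spanned by the nonzero $\pi(v_i)$; the weight of the ray with primitive generator $u$ is $\sum\omega_im_i$, the sum over all $i$ with $\pi(v_i)=m_iu$, $m_i>0$. A one-dimensional Bergman fan in $\mathbb{R}^k$ ($k\ge1$) is the tropical fan with rays generated by $u_0,u_1,\dots,u_k$, all of weight $1$, where $u_1,\dots,u_k$ is a $\mathbb{Z}$-basis of $\mathbb{Z}^k$ and $u_0=-(u_1+\dots+u_k)$. For $l\in(\mathbb{Z}^n)^\vee$ put $\max(0,l)\cdot F=\sum_i\omega_i\max(0,l(v_i))$. If this equals $1$, the gallery of $F$ over $\max(0,l)$ is the set of rays $\mathbb{R}_+v_i$ of $F$ with $|l(v_i)|=1$; it always consists of exactly two rays. The relation on rays "equal, or together forming a gallery of $F$" is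 an equivalence relation; its equivalence classes are called gallery classes here. -}

module Defs where

open import Algebra.Bundles using (Ring)
import Algebra.Construct.Pointwise as Pointwise
open import Algebra.Module.Bundles using (LeftModule)
import Algebra.Module.Construct.TensorUnit as TensorUnit
open import Algebra.Module.Morphism.Structures using (module LeftModuleMorphisms)
import Algebra.Properties.CommutativeMonoid.Sum as Sum
open import Data.Fin.Base using (Fin)
open import Data.Fin.Subset using (Subset; _∈_)
open import Data.Integer.Base as ℤ using (ℤ; +_; 0ℤ; 1ℤ; ∣_∣)
import Data.Integer.Divisibility as ℤ
import Data.Integer.Properties as ℤ
open import Data.Nat.Base as ℕ using (ℕ; suc)
import Data.Nat.Properties as ℕ
open import Data.Product.Base using (∃; ∃₂; _×_; _,_; proj₁)
open import Data.Rational.Base as ℚ using (ℚ)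
import Data.Rational.Properties as ℚ
open import Data.Sum.Base using (_⊎_)
open import Data.Vec.Functional using (Vector; _∷_)
open import Function.Bundles using (_⇔_; _↔_; module Inverse)
open import Function.Definitions using (Injective)
open import Level using (Level; 0ℓ; _⊔_)
open import Relation.Binary.Core using (Rel)
open import Relation.Binary.PropositionalEquality.Core using (_≡_)
open import Relation.Nullary.Negation using (¬_)
open import Relation.Unary using (Pred; _≐_; _∪_; ｛_｝)

private
  variable
    r ℓr m ℓm m′ ℓm′ : Level
    n k q : ℕ

------------------------------------------------------------------------
-- Linear algebra

Free : (R : Ring r ℓr) → ℕ → LeftModule R r ℓr
Free R n = record
  { Carrierᴹ     = Vector Carrier n
  ; _≈ᴹ_         = λ v w → ∀ a → v a ≈ w a
  ; _+ᴹ_         = λ v w a → v a + w a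
  ; _*ₗ_         = λ c v a → c * v a
  ; 0ᴹ           = λ _ → 0#
  ; -ᴹ_          = λ v a → - v a
  ; isLeftModule = record
    { isLeftSemimodule = record
      { +ᴹ-isCommutativeMonoid =
          Pointwise.isCommutativeMonoid (Fin n) +-isCommutativeMonoid
      ; isPreleftSemimodule = record
        { *ₗ-cong      = λ c≈d v≈w a → *-cong c≈d (v≈w a)
        ; *ₗ-zeroˡ     = λ v a → zeroˡ (v a)
        ; *ₗ-distribʳ  = λ v c d a → distribʳ (v a) c d
        ; *ₗ-identityˡ = λ v a → *-identityˡ (v a)
        ; *ₗ-assoc     = λ c d v a → *-assoc c d (v a)
        ; *ₗ-zeroʳ     = λ c a → zeroʳ c
        ; *ₗ-distribˡ  = λ c v w a → distribˡ c (v a) (w a)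
        }
      }
    ; -ᴹ‿cong    = λ v≈w a → -‿cong (v≈w a)
    ; -ᴹ‿inverse = (λ v a → -‿inverseˡ (v a)) , (λ v a → -‿inverseʳ (v a))
    }
  }
  where open Ring R

module _ {R : Ring r ℓr} (M : LeftModule R m ℓm) where
  open Ring R using (Carrier; _≈_; 0#)
  open LeftModule M

  ⅀ : Vector Carrierᴹ q → Carrierᴹ
  ⅀ = Sum.sum +ᴹ-commutativeMonoid

  combination : Vector Carrier q → Vector Carrierᴹ q → Carrierᴹ
  combination c v = ⅀ λ i → c i *ₗ v i

  Spans : Vector Carrierᴹ q → Set (r ⊔ m ⊔ ℓm)
  Spans v = ∀ x → ∃ λ c → x ≈ᴹ combination c v

  LinearlyIndependent : Vector Carrierᴹ q → Set (r ⊔ ℓr ⊔ ℓm)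
  LinearlyIndependent v = ∀ c → combination c v ≈ᴹ 0ᴹ → ∀ i → c i ≈ 0#

  IsBasis : Vector Carrierᴹ q → Set (r ⊔ ℓr ⊔ m ⊔ ℓm)
  IsBasis v = LinearlyIndependent v × Spans v

module _ {R : Ring r ℓr} (M : LeftModule R m ℓm) (N : LeftModule R m′ ℓm′) where
  private
    module M = LeftModule M
    module N = LeftModule N

  LinearMap : Set _
  LinearMap = ∃ (LeftModuleMorphisms.IsLeftModuleHomomorphism
                  M.rawLeftModule N.rawLeftModule)

ℤ^ : ℕ → LeftModule ℤ.+-*-ring 0ℓ 0ℓ
ℤ^ = Free ℤ.+-*-ring

ℚ^ : ℕ → LeftModule ℚ.+-*-ring 0ℓ 0ℓ
ℚ^ = Free ℚ.+-*-ring

Dual : ℕ → Set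
Dual n = LinearMap (ℤ^ n) TensorUnit.leftModule

∑ℕ : Vector ℕ q → ℕ
∑ℕ = Sum.sum ℕ.+-0-commutativeMonoid

∑ℤ : Vector ℤ q → ℤ
∑ℤ = Sum.sum ℤ.+-0-commutativeMonoid

------------------------------------------------------------------------
-- One-dimensional tropical fans

-- The zero vector is not primitive: every d divides all its entries.
Primitive : Vector ℤ n → Set
Primitive v = ∀ d → (∀ a → + d ℤ.∣ v a) → d ≡ 1

-- The rays are indexed by Fin #rays, each given by its primitive
-- generator; two rays agree precisely when their generators do.
record TropicalFan (n : ℕ) : Set where
  open LeftModule (ℤ^ n)
  field
    #rays               : ℕ
    generator           : Vector (Vector ℤ n) #rays
    weight              : Vector ℕ #rays
    generator-primitive : ∀ i → Primitive (generator i)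
    generator-injective : Injective _≡_ _≈ᴹ_ generator
    weight-positive     : ∀ i → 0 ℕ.< weight i
    balanced            : combination (ℤ^ n) (λ i → + weight i) generator ≈ᴹ 0ᴹ

-- The rational span stands for the real one: integer vectors span ℝⁿ
-- over ℝ if and only if they span ℚⁿ over ℚ.
RaysSpan : TropicalFan n → Set
RaysSpan {n} F = Spans (ℚ^ n) λ i a → generator i a ℚ./ 1
  where open TropicalFan F

------------------------------------------------------------------------
-- Push-forward

-- G represents π₊(F), whose rays are only determined up to reindexing.
record IsPushForward (f : LinearMap (ℤ^ n) (ℤ^ k))
                     (F : TropicalFan n) (G : TropicalFan k) : Set where
  private
    module F = TropicalFan F
    module G = TropicalFan G
    π = proj₁ f
  open LeftModule (ℤ^ k)
  field
    -- multiplicity i j is the d > 0 with π(vᵢ) = d uⱼ if there is one,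
    -- and 0 otherwise.
    multiplicity : Fin F.#rays → Fin G.#rays → ℕ
    multiplicity-spec : ∀ i j d → 0 ℕ.< d →
      multiplicity i j ≡ d ⇔ π (F.generator i) ≈ᴹ + d *ₗ G.generator j

    image-ray : ∀ i → ¬ π (F.generator i) ≈ᴹ 0ᴹ →
      ∃₂ λ j d → 0 ℕ.< d × π (F.generator i) ≈ᴹ + d *ₗ G.generator j
    ray-image : ∀ j →
      ∃₂ λ i d → 0 ℕ.< d × π (F.generator i) ≈ᴹ + d *ₗ G.generator j

    weight-sum : ∀ j →
      G.weight j ≡ ∑ℕ λ i → F.weight i ℕ.* multiplicity i j

------------------------------------------------------------------------
-- Bergman fans

record IsBergmanFan (G : TropicalFan k) : Set where
  open TropicalFan G
  open LeftModule (ℤ^ k)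
  field
    k≥1        : 1 ℕ.≤ k
    basis      : Vector (Vector ℤ k) k
    isBasis    : IsBasis (ℤ^ k) basis
    indexing   : Fin (suc k) ↔ Fin #rays
    generators : ∀ i → generator (Inverse.to indexing i)
                         ≈ᴹ ((-ᴹ ⅀ (ℤ^ k) basis) ∷ basis) i
    weights    : ∀ j → weight j ≡ 1

------------------------------------------------------------------------
-- Galleries

module _ (F : TropicalFan n) where
  open TropicalFan F

  max⟨0,_⟩· : Dual n → ℤ
  max⟨0, l , _ ⟩· = ∑ℤ λ i → + weight i ℤ.* (0ℤ ℤ.⊔ l (generator i))

  -- Only meaningful when max⟨0, l ⟩· ≡ 1ℤ.
  gallery : Dual n → Pred (Fin #rays) 0ℓ
  gallery (l , _) i = ∣ l (generator i) ∣ ≡ 1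

  FormGallery : Rel (Fin #rays) 0ℓ
  FormGallery i j = ∃ λ l → max⟨0, l ⟩· ≡ 1ℤ × gallery l ≐ ｛ i ｝ ∪ ｛ j ｝

  GalleryEquivalent : Rel (Fin #rays) 0ℓ
  GalleryEquivalent i j = i ≡ j ⊎ FormGallery i j

  IsGalleryClass : Subset #rays → Set
  IsGalleryClass P = ∃ λ i → ∀ j → j ∈ P ⇔ GalleryEquivalent i j

{-# OPTIONS --safe #-}

-- If max(0,l)·F = 1, then exactly one ray has l > 0, and on it both l and the
-- weight are 1.  Balancing gives max(0,-l)·F = 1 too, so exactly one ray has
-- l < 0, with l = -1 and weight 1, and l vanishes on every other ray.
-- Let p₀, …, pₖ be the rays of the class, p₀ its base point.  Up to sign, the
-- gallery {p₀ , pₐ} then gives a functional lₐ which is -1 on p₀, 1 on pₐ and 0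
-- on every other ray.  Hence π = (l₁, …, lₖ) maps pₐ to the a-th standard basis
-- vector, p₀ to minus the sum of these, and the other rays to 0.
module Submission where

open import Defs
open import Data.Fin.Subset using (Subset; ∣_∣)
open import Data.Nat.Base using (ℕ; suc; _≤_)
open import Data.Product.Base using (Σ; _×_)
open import Relation.Binary.PropositionalEquality.Core using (_≡_)

open import Algebra.Bundles using (CommutativeMonoid)
open import Algebra.Module.Bundles using (LeftModule)
open import Algebra.Module.Morphism.Structures using (module LeftModuleMorphisms)
import Algebra.Properties.CommutativeMonoid.Sum as Sum
open import Data.Bool.Base using (if_then_else_)
open import Data.Fin.Base using (Fin; punchIn) renaming (zero to fzero; suc to fsuc)
import Data.Fin.Properties as Fin
open import Data.Fin.Subset using (_∈_; inside; outside)
open import Data.Integer.Base as ℤ using (ℤ; +_; -[1+_]; 0ℤ; 1ℤ; -1ℤ)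
import Data.Integer.Properties as ℤ
open import Data.Nat.Base as ℕ using (zero; s≤s; z≤n)
import Data.Nat.Divisibility as ℕ
import Data.Nat.Properties as ℕ
open import Data.Product.Base using (∃; ∃₂; _,_; proj₁; proj₂)
open import Data.Sum.Base using (inj₁; inj₂; [_,_]′)
open import Data.Vec.Base as Vec using (here; there)
open import Data.Vec.Functional using (Vector; _∷_)
open import Function.Base using (_∘_; case_of_)
open import Function.Bundles using (mk⇔; Equivalence)
open import Function.Construct.Identity using (↔-id)
open import Function.Definitions using (Injective)
open import Relation.Binary.PropositionalEquality
  using (refl; sym; trans; cong; cong₂; subst; _≢_; module ≡-Reasoning)
open import Relation.Nullary.Decidable using (yes; no; does; dec-true; dec-false)
open import Relation.Nullary.Negation using (¬_; contradiction)

private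
  variable
    n k q : ℕ

-- Finite sums and the Kronecker delta

sum-single : ∀ {c ℓ} (M : CommutativeMonoid c ℓ) →
             let open CommutativeMonoid M using (Carrier; _≈_; ε) in
             (i : Fin q) (t : Vector Carrier q) →
             (∀ j → j ≢ i → t j ≈ ε) → Sum.sum M t ≈ t i
sum-single {q = suc q} M i t t≈ε = begin
  S.sum t                              ≈⟨ S.sum-remove t ⟩
  t i ∙ S.sum (λ j → t (punchIn i j))  ≈⟨ ∙-congˡ (S.sum-cong-≋ λ j → t≈ε _ (Fin.punchInᵢ≢i i j)) ⟩
  t i ∙ S.sum {q} (λ _ → ε)            ≈⟨ ∙-congˡ (S.sum-replicate-zero q) ⟩
  t i ∙ ε                              ≈⟨ identityʳ (t i) ⟩
  t i                                  ∎
  where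
  open CommutativeMonoid M
  module S = Sum M
  open import Relation.Binary.Reasoning.Setoid setoid

∑ℤ-cong : {s t : Vector ℤ q} → (∀ i → s i ≡ t i) → ∑ℤ s ≡ ∑ℤ t
∑ℤ-cong = Sum.sum-cong-≗ ℤ.+-0-commutativeMonoid

∑ℤ-+ : (t : Vector ℕ q) → ∑ℤ (λ i → + t i) ≡ + ∑ℕ t
∑ℤ-+ {zero}  t = refl
∑ℤ-+ {suc q} t = cong (ℤ._+_ (+ t fzero)) (∑ℤ-+ (t ∘ fsuc))

∑ℕ≡0⇒≡0 : (t : Vector ℕ q) → ∑ℕ t ≡ 0 → ∀ i → t i ≡ 0
∑ℕ≡0⇒≡0 t ∑≡0 fzero    = ℕ.m+n≡0⇒m≡0 (t fzero) ∑≡0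
∑ℕ≡0⇒≡0 t ∑≡0 (fsuc i) = ∑ℕ≡0⇒≡0 (t ∘ fsuc) (ℕ.m+n≡0⇒n≡0 (t fzero) ∑≡0) i

∑ℕ≡1⇒single : (t : Vector ℕ q) → ∑ℕ t ≡ 1 →
              ∃ λ i → t i ≡ 1 × ∀ j → j ≢ i → t j ≡ 0
∑ℕ≡1⇒single {suc q} t ∑≡1 with t fzero in t₀≡
... | 1    = fzero , t₀≡ , λ
  { fzero    0≢0 → contradiction refl 0≢0
  ; (fsuc j) _   → ∑ℕ≡0⇒≡0 (t ∘ fsuc) (ℕ.suc-injective ∑≡1) j
  }
... | zero with i , tᵢ≡1 , t≡0 ← ∑ℕ≡1⇒single (t ∘ fsuc) ∑≡1 = fsuc i , tᵢ≡1 , λ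
  { fzero    _   → t₀≡
  ; (fsuc j) j≢i → t≡0 j (j≢i ∘ cong fsuc)
  }

δ : Fin n → Fin n → ℕ
δ i j = if does (i Fin.≟ j) then 1 else 0

δ-≡ : (i : Fin n) → δ i i ≡ 1
δ-≡ i = cong (if_then 1 else 0) (dec-true (i Fin.≟ i) refl)

δ-≢ : {i j : Fin n} → i ≢ j → δ i j ≡ 0
δ-≢ i≢j = cong (if_then 1 else 0) (dec-false (_ Fin.≟ _) i≢j)

-- Linear algebra over ℤ

⅀-lookup : (v : Vector (Vector ℤ n) q) (a : Fin n) →
           ⅀ (ℤ^ n) v a ≡ ∑ℤ λ i → v i a
⅀-lookup {q = zero}  v a = refl
⅀-lookup {q = suc q} v a = cong (ℤ._+_ (v fzero a)) (⅀-lookup (v ∘ fsuc) a)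

module Hom = LeftModuleMorphisms.IsLeftModuleHomomorphism

dual-combination : ((l , _) : Dual n) (c : Vector ℤ q) (v : Vector (Vector ℤ n) q) →
                   l (combination (ℤ^ n) c v) ≡ ∑ℤ λ i → c i ℤ.* l (v i)
dual-combination {q = zero}  (l , h) c v = Hom.0ᴹ-homo h
dual-combination {q = suc q} (l , h) c v = trans
  (Hom.+ᴹ-homo h (λ a → c fzero ℤ.* v fzero a) (combination (ℤ^ _) (c ∘ fsuc) (v ∘ fsuc)))
  (cong₂ ℤ._+_ (Hom.*ₗ-homo h (c fzero) (v fzero)) (dual-combination (l , h) (c ∘ fsuc) (v ∘ fsuc)))

negate : Dual n → Dual n
negate (l , h) = ℤ.-_ ∘ l , record
  { +ᴹ-isGroupHomomorphism = record
    { isMonoidHomomorphism = record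
      { isMagmaHomomorphism = record
        { isRelHomomorphism = record { cong = cong ℤ.-_ ∘ Hom.⟦⟧-cong h }
        ; homo = λ v w → trans (cong ℤ.-_ (Hom.+ᴹ-homo h v w)) (ℤ.neg-distrib-+ (l v) (l w))
        }
      ; ε-homo = cong ℤ.-_ (Hom.0ᴹ-homo h)
      }
    ; ⁻¹-homo = cong ℤ.-_ ∘ Hom.-ᴹ-homo h
    }
  ; *ₗ-homo = λ c v → trans (cong ℤ.-_ (Hom.*ₗ-homo h c v)) (ℤ.neg-distribʳ-* c (l v))
  }

tuple : Vector (Dual n) k → LinearMap (ℤ^ n) (ℤ^ k)
tuple l = (λ v a → proj₁ (l a) v) , record
  { +ᴹ-isGroupHomomorphism = record
    { isMonoidHomomorphism = record
      { isMagmaHomomorphism = record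
        { isRelHomomorphism = record { cong = λ v≈w a → Hom.⟦⟧-cong (proj₂ (l a)) v≈w }
        ; homo = λ v w a → Hom.+ᴹ-homo (proj₂ (l a)) v w
        }
      ; ε-homo = λ a → Hom.0ᴹ-homo (proj₂ (l a))
      }
    ; ⁻¹-homo = λ v a → Hom.-ᴹ-homo (proj₂ (l a)) v
    }
  ; *ₗ-homo = λ c v a → Hom.*ₗ-homo (proj₂ (l a)) c v
  }

unit⇒primitive : (v : Vector ℤ n) (a : Fin n) → ℤ.∣ v a ∣ ≡ 1 → Primitive v
unit⇒primitive v a ∣vₐ∣≡1 d d∣v = ℕ.∣1⇒≡1 (subst (d ℕ.∣_) ∣vₐ∣≡1 (d∣v a))

primitive⇒≉0 : {v : Vector ℤ n} → Primitive v → ¬ (∀ a → v a ≡ 0ℤ)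
primitive⇒≉0 v-primitive v≈0 =
  case v-primitive 0 (λ a → subst (λ x → 0 ℕ.∣ ℤ.∣ x ∣) (sym (v≈0 a)) ℕ.∣-refl) of λ ()

primitive-multiple : {v w : Vector ℤ n} → Primitive v →
                     ∀ d → (∀ a → v a ≡ + d ℤ.* w a) → d ≡ 1
primitive-multiple {w = w} v-primitive d v≈dw = v-primitive d λ a →
  subst (d ℕ.∣_)
    (sym (trans (cong ℤ.∣_∣ (v≈dw a)) (ℤ.abs-* (+ d) (w a))))
    (ℕ.m∣m*n ℤ.∣ w a ∣)

e : Vector (Vector ℤ k) k
e a b = + δ a b

combination-e : (c : Vector ℤ k) → ∀ a → combination (ℤ^ k) c e a ≡ c a
combination-e {k} c a = begin
  combination (ℤ^ k) c e a    ≡⟨ ⅀-lookup (λ b a → c b ℤ.* e b a) a ⟩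
  ∑ℤ (λ b → c b ℤ.* + δ b a)  ≡⟨ sum-single ℤ.+-0-commutativeMonoid a _ (λ b b≢a →
                                   trans (cong (λ x → c b ℤ.* + x) (δ-≢ b≢a)) (ℤ.*-zeroʳ (c b))) ⟩
  c a ℤ.* + δ a a             ≡⟨ cong (λ x → c a ℤ.* + x) (δ-≡ a) ⟩
  c a ℤ.* 1ℤ                  ≡⟨ ℤ.*-identityʳ (c a) ⟩
  c a                         ∎
  where open ≡-Reasoning

e-isBasis : IsBasis (ℤ^ k) e
e-isBasis =
  (λ c c·e≈0 a → trans (sym (combination-e c a)) (c·e≈0 a)) ,
  (λ x → x , λ a → sym (combination-e x a))

⅀-e : ∀ a → ⅀ (ℤ^ k) e a ≡ 1ℤ
⅀-e a = begin
  ⅀ (ℤ^ _) e a        ≡⟨ ⅀-lookup e a ⟩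
  ∑ℤ (λ b → + δ b a)  ≡⟨ sum-single ℤ.+-0-commutativeMonoid a _ (λ b b≢a → cong +_ (δ-≢ b≢a)) ⟩
  + δ a a             ≡⟨ cong +_ (δ-≡ a) ⟩
  1ℤ                  ∎
  where open ≡-Reasoning

-- The standard Bergman fan

u : Vector (Vector ℤ k) (suc k)
u {k} = LeftModule.-ᴹ_ (ℤ^ k) (⅀ (ℤ^ k) e) ∷ e

u₀≡-1 : ∀ a → u {k} fzero a ≡ -1ℤ
u₀≡-1 a = cong ℤ.-_ (⅀-e a)

u-primitive : ∀ i → Primitive (u {suc k} i)
u-primitive {k} fzero =
  unit⇒primitive (u fzero) fzero (cong ℤ.∣_∣ (u₀≡-1 {suc k} fzero))
u-primitive (fsuc a) = unit⇒primitive (u (fsuc a)) a (δ-≡ a)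

u₀≉e : ∀ a → ¬ (∀ b → u {k} fzero b ≡ e a b)
u₀≉e a u₀≈e = case trans (sym (u₀≡-1 a)) (u₀≈e a) of λ ()

u-injective : Injective _≡_ (LeftModule._≈ᴹ_ (ℤ^ k)) u
u-injective {x = fzero}  {fzero}  _    = refl
u-injective {x = fzero}  {fsuc b} u≈u′ = contradiction u≈u′ (u₀≉e b)
u-injective {x = fsuc a} {fzero}  u≈u′ = contradiction (sym ∘ u≈u′) (u₀≉e a)
u-injective {x = fsuc a} {fsuc b} u≈u′ with a Fin.≟ b
... | yes a≡b = cong fsuc a≡b
... | no  a≢b = case (begin
  1ℤ       ≡⟨ cong +_ (δ-≡ a) ⟨
  + δ a a  ≡⟨ u≈u′ a ⟩
  + δ b a  ≡⟨ cong +_ (δ-≢ (a≢b ∘ sym)) ⟩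
  0ℤ       ∎) of λ ()
  where open ≡-Reasoning

u-balanced : ∀ a → combination (ℤ^ k) (λ _ → 1ℤ) u a ≡ 0ℤ
u-balanced a = cong₂ (λ x y → 1ℤ ℤ.* x ℤ.+ y) (u₀≡-1 a) (combination-e (λ _ → 1ℤ) a)

bergmanFan : ∀ k → TropicalFan (suc k)
bergmanFan k = record
  { #rays               = suc (suc k)
  ; generator           = u
  ; weight              = λ _ → 1
  ; generator-primitive = u-primitive
  ; generator-injective = u-injective
  ; weight-positive     = λ _ → s≤s z≤n
  ; balanced            = u-balanced
  }

bergmanFan-isBergmanFan : ∀ k → IsBergmanFan (bergmanFan k)
bergmanFan-isBergmanFan k = record
  { k≥1        = s≤s z≤n
  ; basis      = e
  ; isBasis    = e-isBasis
  ; indexing   = ↔-id _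
  ; generators = λ _ _ → refl
  ; weights    = λ _ → refl
  }

-- Push-forward

module _ (f : LinearMap (ℤ^ n) (ℤ^ k)) (F : TropicalFan n) (G : TropicalFan k) where
  private
    module F = TropicalFan F
    module G = TropicalFan G
    π = proj₁ f
  open LeftModule (ℤ^ k) using (_≈ᴹ_; _*ₗ_; 0ᴹ)

  isPushForward : (p : Fin G.#rays → Fin F.#rays) →
    (∀ j → π (F.generator (p j)) ≈ᴹ G.generator j) →
    (∀ j → F.weight (p j) ≡ G.weight j) →
    (∀ i → (∀ j → p j ≢ i) → π (F.generator i) ≈ᴹ 0ᴹ) →
    IsPushForward f F G
  isPushForward p π-p weight-p π-rest = record
    { multiplicity      = λ i j → δ (p j) i
    ; multiplicity-spec = λ i j d 0<d → mk⇔ (δ≡d⇒ i j d 0<d) (⇒δ≡d i j d 0<d)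
    ; image-ray         = image-ray
    ; ray-image         = λ j → p j , 1 , s≤s z≤n , π-p′ j
    ; weight-sum        = weight-sum
    }
    where
    π-p′ : ∀ j → π (F.generator (p j)) ≈ᴹ 1ℤ *ₗ G.generator j
    π-p′ j a = trans (π-p j a) (sym (ℤ.*-identityˡ (G.generator j a)))

    δ≡d⇒ : ∀ i j d → 0 ℕ.< d → δ (p j) i ≡ d →
           π (F.generator i) ≈ᴹ + d *ₗ G.generator j
    δ≡d⇒ i j d 0<d δ≡d with p j Fin.≟ i
    δ≡d⇒ i j _ 0<d refl | yes refl = π-p′ j
    δ≡d⇒ i j _ ()  refl | no _

    ⇒δ≡d : ∀ i j d → 0 ℕ.< d → π (F.generator i) ≈ᴹ + d *ₗ G.generator j →
           δ (p j) i ≡ d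
    ⇒δ≡d i j (suc d) 0<d πᵢ≈d*j with Fin.any? (λ j′ → p j′ Fin.≟ i)
    ... | no  i∉p = contradiction
      (λ a → [ (λ ()) , (λ gⱼₐ≡0 → gⱼₐ≡0) ]′
        (ℤ.i*j≡0⇒i≡0∨j≡0 (+ suc d)
          (trans (sym (πᵢ≈d*j a)) (π-rest i (λ j′ pj′≡i → i∉p (j′ , pj′≡i)) a))))
      (primitive⇒≉0 (G.generator-primitive j))
    ... | yes (j′ , refl)
      with refl ← primitive-multiple {w = G.generator j} (G.generator-primitive j′) (suc d)
                    (λ a → trans (sym (π-p j′ a)) (πᵢ≈d*j a))
      with refl ← G.generator-injective {j} {j′} (λ a →
                    trans (sym (ℤ.*-identityˡ (G.generator j a)))
                          (trans (sym (πᵢ≈d*j a)) (π-p j′ a)))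
      = δ-≡ (p j)

    image-ray : ∀ i → ¬ π (F.generator i) ≈ᴹ 0ᴹ →
      ∃₂ λ j d → 0 ℕ.< d × π (F.generator i) ≈ᴹ + d *ₗ G.generator j
    image-ray i πᵢ≉0 with Fin.any? (λ j → p j Fin.≟ i)
    ... | yes (j , refl) = j , 1 , s≤s z≤n , π-p′ j
    ... | no  i∉p        =
      contradiction (π-rest i λ j pj≡i → i∉p (j , pj≡i)) πᵢ≉0

    weight-sum : ∀ j → G.weight j ≡ ∑ℕ λ i → F.weight i ℕ.* δ (p j) i
    weight-sum j = sym (begin
      ∑ℕ (λ i → F.weight i ℕ.* δ (p j) i)  ≡⟨ sum-single ℕ.+-0-commutativeMonoid (p j) _ (λ i i≢pj →
                                                trans (cong (F.weight i ℕ.*_) (δ-≢ (i≢pj ∘ sym)))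
                                                      (ℕ.*-zeroʳ (F.weight i))) ⟩
      F.weight (p j) ℕ.* δ (p j) (p j)     ≡⟨ cong₂ ℕ._*_ (weight-p j) (δ-≡ (p j)) ⟩
      G.weight j ℕ.* 1                     ≡⟨ ℕ.*-identityʳ (G.weight j) ⟩
      G.weight j                           ∎)
      where open ≡-Reasoning

-- Galleries

infix 8 _⁺
_⁺ : ℤ → ℕ
(+ x)    ⁺ = x
-[1+ _ ] ⁺ = 0

0⊔x≡x⁺ : ∀ x → 0ℤ ℤ.⊔ x ≡ + (x ⁺)
0⊔x≡x⁺ (+ _)    = refl
0⊔x≡x⁺ -[1+ _ ] = refl

x+0⊔-x≡0⊔x : ∀ x → x ℤ.+ (0ℤ ℤ.⊔ ℤ.- x) ≡ 0ℤ ℤ.⊔ x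
x+0⊔-x≡0⊔x (+ zero)   = refl
x+0⊔-x≡0⊔x (+ suc x)  = ℤ.+-identityʳ (+ suc x)
x+0⊔-x≡0⊔x (-[1+ x ]) = ℤ.+-inverseʳ -[1+ x ]

x⁺≡1⇒x≡1 : ∀ x → x ⁺ ≡ 1 → x ≡ 1ℤ
x⁺≡1⇒x≡1 (+ _) refl = refl

x⁺≡0∧[-x]⁺≡0⇒x≡0 : ∀ x → x ⁺ ≡ 0 → (ℤ.- x) ⁺ ≡ 0 → x ≡ 0ℤ
x⁺≡0∧[-x]⁺≡0⇒x≡0 (+ _) refl _ = refl

module _ (F : TropicalFan n) where
  open TropicalFan F

  max⟨0,negate⟩ : ∀ l → max⟨0, F ⟩· (negate l) ≡ max⟨0, F ⟩· l
  max⟨0,negate⟩ (l , h) = begin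
    ∑ℤ neg                        ≡⟨ ℤ.+-identityˡ _ ⟨
    0ℤ ℤ.+ ∑ℤ neg                 ≡⟨ cong (ℤ._+ ∑ℤ neg) (trans (Hom.⟦⟧-cong h balanced) (Hom.0ᴹ-homo h)) ⟨
    l (combination (ℤ^ _) ω generator) ℤ.+ ∑ℤ neg
                                  ≡⟨ cong (ℤ._+ ∑ℤ neg) (dual-combination (l , h) ω generator) ⟩
    ∑ℤ val ℤ.+ ∑ℤ neg             ≡⟨ Sum.∑-distrib-+ ℤ.+-0-commutativeMonoid val neg ⟨
    ∑ℤ (λ i → val i ℤ.+ neg i)    ≡⟨ ∑ℤ-cong (λ i → trans
                                       (sym (ℤ.*-distribˡ-+ (ω i) (a i) (0ℤ ℤ.⊔ ℤ.- a i)))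
                                       (cong (ω i ℤ.*_) (x+0⊔-x≡0⊔x (a i)))) ⟩
    max⟨0, F ⟩· (l , h)           ∎
    where
    open ≡-Reasoning
    ω a val neg : Vector ℤ #rays
    ω i   = + weight i
    a i   = l (generator i)
    val i = ω i ℤ.* a i
    neg i = ω i ℤ.* (0ℤ ℤ.⊔ ℤ.- a i)

  positive-ray : ∀ l → max⟨0, F ⟩· l ≡ 1ℤ →
    ∃ λ i → weight i ≡ 1 × proj₁ l (generator i) ≡ 1ℤ ×
            ∀ j → j ≢ i → proj₁ l (generator j) ⁺ ≡ 0
  positive-ray (l , h) max≡1 =
    let i , ωa⁺≡1 , ωa⁺≡0 = ∑ℕ≡1⇒single ωa⁺ ∑≡1
    in i
    , ℕ.m*n≡1⇒m≡1 (weight i) _ ωa⁺≡1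
    , x⁺≡1⇒x≡1 _ (ℕ.m*n≡1⇒n≡1 (weight i) _ ωa⁺≡1)
    , λ j j≢i → [ (λ ω≡0 → contradiction (sym ω≡0) (ℕ.<⇒≢ (weight-positive j)))
                , (λ a⁺≡0 → a⁺≡0)
                ]′ (ℕ.m*n≡0⇒m≡0∨n≡0 (weight j) (ωa⁺≡0 j j≢i))
    where
    ωa⁺ : Vector ℕ #rays
    ωa⁺ i = weight i ℕ.* l (generator i) ⁺

    ∑≡1 : ∑ℕ ωa⁺ ≡ 1
    ∑≡1 = ℤ.+-injective (trans
      (sym (∑ℤ-+ ωa⁺))
      (trans
        (∑ℤ-cong λ i → trans
          (ℤ.pos-* (weight i) (l (generator i) ⁺))
          (cong (+ weight i ℤ.*_) (sym (0⊔x≡x⁺ (l (generator i))))))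
        max≡1))

  record Separates (i j : Fin #rays) (l : Dual n) : Set where
    field
      weightˡ : weight i ≡ 1
      weightʳ : weight j ≡ 1
      at-i    : proj₁ l (generator i) ≡ -1ℤ
      at-j    : proj₁ l (generator j) ≡ 1ℤ
      at-rest : ∀ m → m ≢ i → m ≢ j → proj₁ l (generator m) ≡ 0ℤ

  separates-negate : ∀ {i j l} → Separates i j l → Separates j i (negate l)
  separates-negate s = record
    { weightˡ = weightʳ
    ; weightʳ = weightˡ
    ; at-i    = cong ℤ.-_ at-j
    ; at-j    = cong ℤ.-_ at-i
    ; at-rest = λ m m≢j m≢i → cong ℤ.-_ (at-rest m m≢i m≢j)
    }
    where open Separates s

  max≡1⇒separates : ∀ l → max⟨0, F ⟩· l ≡ 1ℤ → ∃₂ λ i j → Separates i j l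
  max≡1⇒separates l max≡1
    with j , ωⱼ≡1 , aⱼ≡1 , a⁺≡0 ← positive-ray l max≡1
    with i , ωᵢ≡1 , -aᵢ≡1 , -a⁺≡0 ← positive-ray (negate l) (trans (max⟨0,negate⟩ l) max≡1)
    = i , j , record
    { weightˡ = ωᵢ≡1
    ; weightʳ = ωⱼ≡1
    ; at-i    = ℤ.neg-injective -aᵢ≡1
    ; at-j    = aⱼ≡1
    ; at-rest = λ m m≢i m≢j → x⁺≡0∧[-x]⁺≡0⇒x≡0 _ (a⁺≡0 m m≢j) (-a⁺≡0 m m≢i)
    }

  formGallery⇒separates : ∀ {i j} → FormGallery F i j → ∃ (Separates i j)
  formGallery⇒separates (l , max≡1 , gallery⊆ , _)
    with x , y , s ← max≡1⇒separates l max≡1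
    with gallery⊆ {x} (cong ℤ.∣_∣ (Separates.at-i s))
       | gallery⊆ {y} (cong ℤ.∣_∣ (Separates.at-j s))
  ... | inj₁ refl | inj₂ refl = l , s
  ... | inj₂ refl | inj₁ refl = negate l , separates-negate s
  ... | inj₁ refl | inj₁ refl = case trans (sym (Separates.at-i s)) (Separates.at-j s) of λ ()
  ... | inj₂ refl | inj₂ refl = case trans (sym (Separates.at-i s)) (Separates.at-j s) of λ ()

-- Enumerating a subset

enumerate : (p : Subset n) → Fin ∣ p ∣ → Fin n
enumerate (outside Vec.∷ p) a        = fsuc (enumerate p a)
enumerate (inside  Vec.∷ p) fzero    = fzero
enumerate (inside  Vec.∷ p) (fsuc a) = fsuc (enumerate p a)

enumerate-injective : (p : Subset n) → Injective _≡_ _≡_ (enumerate p)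
enumerate-injective (outside Vec.∷ p) eq = enumerate-injective p (Fin.suc-injective eq)
enumerate-injective (inside  Vec.∷ p) {fzero}  {fzero}  eq = refl
enumerate-injective (inside  Vec.∷ p) {fsuc a} {fsuc b} eq =
  cong fsuc (enumerate-injective p (Fin.suc-injective eq))

enumerate-∈ : (p : Subset n) → ∀ a → enumerate p a ∈ p
enumerate-∈ (outside Vec.∷ p) a        = there (enumerate-∈ p a)
enumerate-∈ (inside  Vec.∷ p) fzero    = here
enumerate-∈ (inside  Vec.∷ p) (fsuc a) = there (enumerate-∈ p a)

enumerate-surjective : (p : Subset n) → ∀ {i} → i ∈ p → ∃ λ a → enumerate p a ≡ i
enumerate-surjective (inside  Vec.∷ p) here = fzero , refl
enumerate-surjective (inside  Vec.∷ p) (there i∈p) with a , refl ← enumerate-surjective p i∈p =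
  fsuc a , refl
enumerate-surjective (outside Vec.∷ p) (there i∈p) with a , refl ← enumerate-surjective p i∈p =
  a , refl

others : (p : Subset n) → ∀ {i} → i ∈ p → ∣ p ∣ ≡ suc k →
         ∃ λ (o : Fin k → Fin n) → Injective _≡_ _≡_ o × ∀ a → o a ∈ p × o a ≢ i
others p i∈p ∣p∣≡1+k with ∣ p ∣ | ∣p∣≡1+k | enumerate p | enumerate-injective p | enumerate-∈ p
                          | enumerate-surjective p i∈p
... | _ | refl | f | f-injective | f-∈ | b , refl =
  f ∘ punchIn b ,
  (λ eq → Fin.punchIn-injective b _ _ (f-injective eq)) ,
  λ a → f-∈ (punchIn b a) , λ eq → Fin.punchInᵢ≢i b a (f-injective eq)

lemma3p15 : ∀ {n} (F : TropicalFan n) → RaysSpan F →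
    ∀ (P : Subset (TropicalFan.#rays F)) → IsGalleryClass F P →
    ∀ k → 2 ≤ suc k → ∣ P ∣ ≡ suc k →
    Σ (LinearMap (ℤ^ n) (ℤ^ k)) λ π →
    Σ (TropicalFan k) λ G → IsPushForward π F G × IsBergmanFan G
lemma3p15 _ _ _ _ zero (s≤s ())
lemma3p15 {n} F _ P (i₀ , class) (suc k) _ ∣P∣≡2+k
  with o , o-injective , o-spec ← others P (Equivalence.from (class i₀) (inj₁ refl)) ∣P∣≡2+k
  = tuple l , bergmanFan k , isPushForward (tuple l) F (bergmanFan k) p π-p weight-p π-rest
  , bergmanFan-isBergmanFan k
  where
  open TropicalFan F

  separated : ∀ a → ∃ (Separates F i₀ (o a))
  separated a with Equivalence.to (class (o a)) (proj₁ (o-spec a))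
  ... | inj₁ i₀≡oa   = contradiction (sym i₀≡oa) (proj₂ (o-spec a))
  ... | inj₂ gallery = formGallery⇒separates F gallery

  l : Vector (Dual n) (suc k)
  l = proj₁ ∘ separated

  module S a = Separates (proj₂ (separated a))

  p : Fin (suc (suc k)) → Fin #rays
  p = i₀ ∷ o

  π-p : ∀ j a → proj₁ (l a) (generator (p j)) ≡ u j a
  π-p fzero    a = trans (S.at-i a) (sym (u₀≡-1 a))
  π-p (fsuc b) a with b Fin.≟ a
  ... | yes refl = S.at-j a
  ... | no  b≢a  = S.at-rest a (o b) (proj₂ (o-spec b)) (b≢a ∘ o-injective)

  weight-p : ∀ j → weight (p j) ≡ 1
  weight-p fzero    = S.weightˡ fzero
  weight-p (fsuc a) = S.weightʳ a

  π-rest : ∀ i → (∀ j → p j ≢ i) → ∀ a → proj₁ (l a) (generator i) ≡ 0ℤ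
  π-rest i p≢i a = S.at-rest a i (p≢i fzero ∘ sym) (p≢i (fsuc a) ∘ sym)
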